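{- Let $G$ be a class 2 graph with maximum degree $\Delta$, and let $r\in V(G)$ be a light $\Delta$-vertex. For any $s\in N(r)$ with $d(s)<\Delta$, if $rs$ is a critical edge of $G$, then all vertices in $N(s)\setminus N(r)$ are $\Delta$-vertices.
   Context: All graphs are finite and simple. $\chi'(G)$ is the chromatic index; $G$ is class 2 if $\chi'(G)=\Delta(G)+1$, where $\Delta(G)$ is the maximum degree. $N(v)$ is the set of neighbors of $v$ in $G$ and $d(v)=|N(v)|$. A $k$-vertex is a vertex of degree $k$ in $G$. A vertex is light if it is adjacent to at most two $\Delta(G)$-vertices. An edge $e$ of $G$ is critical if $\chi'(G-e)<\chi'(G)$. -}

module Defs where

open import Data.Nat using (ℕ; zero; suc; _+_; _^_; _≤_; _<_; z≤n; s≤s)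
open import Data.Nat.Properties using (+-comm; +-cancelˡ-≡; +-mono-<; _≟_)
open import Data.Fin using (Fin; toℕ; fromℕ<; finToFun; funToFin)
open import Data.Fin.Properties as Fin
  using (any?; all?; toℕ<n; toℕ-injective; toℕ-fromℕ<; finToFun-funToFin)
open import Data.Fin.Subset using (Subset; ∣_∣; _∩_)
open import Data.List using (map; allFin)
open import Data.List.Extrema.Nat using (max)
open import Data.Product using (∃; ∃-syntax; _×_; _,_; proj₁; proj₂)
open import Data.Sum using (_⊎_; inj₁; inj₂)
open import Data.Vec using (tabulate)
open import Function using (_∘_)
open import Level using (0ℓ)
open import Relation.Binary using (Rel; Symmetric; Irreflexive; Decidable)
open import Relation.Binary.PropositionalEquality using (_≡_; _≢_; sym; trans; cong)
open import Relation.Nullary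
  using (¬_; Dec; yes; no; does; contradiction; ¬?; _×-dec_; _⊎-dec_; _→-dec_)
open import Relation.Nullary.Decidable using (map′)
open import Relation.Unary using (Pred) renaming (Decidable to Decidable₁)

-- Finite simple graphs with vertex set Fin n.
record Graph (n : ℕ) : Set₁ where
  infix 4 _~_ _~?_
  field
    _~_      : Rel (Fin n) 0ℓ
    ~-sym    : Symmetric _~_
    ~-irrefl : Irreflexive _≡_ _~_
    _~?_     : Decidable _~_

module _ {n : ℕ} (G : Graph n) where
  open Graph G

  N : Fin n → Subset n
  N v = tabulate λ u → does (v ~? u)

  d : Fin n → ℕ
  d v = ∣ N v ∣

  -- The base value 0 only matters when n is 0.
  Δ : ℕ
  Δ = max 0 (map d (allFin n))

  IsVertexOfDegree : ℕ → Fin n → Set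
  IsVertexOfDegree k v = d v ≡ k

  verticesOfDegree : ℕ → Subset n
  verticesOfDegree k = tabulate λ v → does (d v ≟ k)

  Light : Fin n → Set
  Light v = ∣ N v ∩ verticesOfDegree Δ ∣ ≤ 2

  -- An undirected edge is represented by proofs of u ~ v and of v ~ u, which
  -- need not be unique; colour-sym gives all of them the same colour.
  record EdgeColouring (k : ℕ) : Set where
    field
      colour     : ∀ {u v} → u ~ v → Fin k
      colour-sym : ∀ {u v} (e : u ~ v) (f : v ~ u) → colour e ≡ colour f
      proper     : ∀ {u v w} (e : u ~ v) (f : u ~ w) → v ≢ w → colour e ≢ colour f

module _ {n : ℕ} (G : Graph n) (a b : Fin n) where
  open Graph G

  SameEdge : Rel (Fin n) 0ℓ
  SameEdge u v = (u ≡ a × v ≡ b) ⊎ (u ≡ b × v ≡ a)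

  -- G - ab: the vertex set is unchanged.
  deleteEdge : Graph n
  deleteEdge = record
    { _~_      = λ u v → u ~ v × ¬ SameEdge u v
    ; ~-sym    = λ (e , ne) → ~-sym e , ne ∘ swap
    ; ~-irrefl = λ eq (e , _) → ~-irrefl eq e
    ; _~?_     = λ u v → (u ~? v) ×-dec
        ¬? ((u Fin.≟ a ×-dec v Fin.≟ b) ⊎-dec (u Fin.≟ b ×-dec v Fin.≟ a))
    }
    where
    swap : ∀ {u v} → SameEdge v u → SameEdge u v
    swap (inj₁ (p , q)) = inj₂ (q , p)
    swap (inj₂ (p , q)) = inj₁ (q , p)

IsLeast : Pred ℕ 0ℓ → ℕ → Set
IsLeast P k = P k × (∀ j → P j → k ≤ j)

least : {P : Pred ℕ 0ℓ} → Decidable₁ P → ∀ b → P b → ∃ (IsLeast P)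
least P? b pb with P? 0
least P? b       pb | yes p0 = 0 , p0 , λ _ _ → z≤n
least P? zero    pb | no ¬p0 = contradiction pb ¬p0
least {P} P? (suc b) pb | no ¬p0 with least (P? ∘ suc) b pb
... | k , pk , k≤ = suc k , pk , bound
  where
  bound : ∀ j → P j → suc k ≤ j
  bound zero    p = contradiction p ¬p0
  bound (suc j) p = s≤s (k≤ j p)

module _ {n : ℕ} (G : Graph n) where
  open Graph G

  private
    ProperMatrix : ∀ {k} → (Fin n → Fin n → Fin k) → Set
    ProperMatrix c =
      (∀ u v → u ~ v → c u v ≡ c v u) ×
      (∀ u v w → u ~ v → u ~ w → v ≢ w → c u v ≢ c u w)

    properMatrix? : ∀ {k} (c : Fin n → Fin n → Fin k) → Dec (ProperMatrix c)
    properMatrix? c =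
      (all? λ u → all? λ v → (u ~? v) →-dec (c u v Fin.≟ c v u))
      ×-dec
      (all? λ u → all? λ v → all? λ w → (u ~? v) →-dec ((u ~? w) →-dec
        (¬? (v Fin.≟ w) →-dec ¬? (c u v Fin.≟ c u w))))

    properMatrix-resp : ∀ {k} {c c′ : Fin n → Fin n → Fin k} →
      (∀ u v → c′ u v ≡ c u v) → ProperMatrix c → ProperMatrix c′
    properMatrix-resp eq (s , p) =
      (λ u v e → trans (eq u v) (trans (s u v e) (sym (eq v u)))) ,
      (λ u v w e f v≢w q → p u v w e f v≢w (trans (sym (eq u v)) (trans q (eq u w))))

    decode : ∀ {k} → Fin ((k ^ n) ^ n) → Fin n → Fin n → Fin k
    decode {k} i u = finToFun {k} (finToFun {k ^ n} i u)

    encode : ∀ {k} → (Fin n → Fin n → Fin k) → Fin ((k ^ n) ^ n)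
    encode c = funToFin (λ u → funToFin (c u))

    decode-encode : ∀ {k} (c : Fin n → Fin n → Fin k) u v →
                    decode (encode c) u v ≡ c u v
    decode-encode c u v =
      trans (cong (λ x → finToFun x v) (finToFun-funToFin (λ u → funToFin (c u)) u))
            (finToFun-funToFin (c u) v)

    matrix? : ∀ k → Dec (∃[ c ] ProperMatrix {k} c)
    matrix? k = map′
      (λ (i , p) → decode i , p)
      (λ (c , p) → encode c , properMatrix-resp (decode-encode c) p)
      (any? λ i → properMatrix? (decode {k} i))

    fromMatrix : ∀ {k} → ∃[ c ] ProperMatrix {k} c → EdgeColouring G k
    fromMatrix (c , s , p) = record
      { colour     = λ {u} {v} _ → c u v
      ; colour-sym = λ {u} {v} e _ → s u v e
      ; proper     = λ {u} {v} {w} → p u v w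
      }

    toMatrix : ∀ {k} → EdgeColouring G (suc k) → ∃[ c ] ProperMatrix {suc k} c
    toMatrix {k} C = c , s , p
      where
      open EdgeColouring C
      c : Fin n → Fin n → Fin (suc k)
      c u v with u ~? v
      ... | yes e = colour e
      ... | no  _ = Fin.zero
      c-edge : ∀ u v (e : u ~ v) → c u v ≡ colour e
      c-edge u v e with u ~? v
      ... | yes e′ = trans (colour-sym e′ (~-sym e)) (sym (colour-sym e (~-sym e)))
      ... | no  ¬e = contradiction e ¬e
      s : ∀ u v → u ~ v → c u v ≡ c v u
      s u v e = trans (c-edge u v e)
        (trans (colour-sym e (~-sym e)) (sym (c-edge v u (~-sym e))))
      p : ∀ u v w → u ~ v → u ~ w → v ≢ w → c u v ≢ c u w
      p u v w e f v≢w q = proper e f v≢w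
        (trans (sym (c-edge u v e)) (trans q (c-edge u w f)))

  edgeColouring? : ∀ k → Dec (EdgeColouring G k)
  edgeColouring? (suc k) = map′ fromMatrix toMatrix (matrix? (suc k))
  edgeColouring? zero with any? (λ u → any? (λ v → u ~? v))
  ... | yes (_ , _ , e) = no λ C → ¬Fin0 (EdgeColouring.colour C e)
    where
    ¬Fin0 : ¬ Fin 0
    ¬Fin0 ()
  ... | no ¬e = yes record
    { colour     = λ e → contradiction (_ , _ , e) ¬e
    ; colour-sym = λ e _ → contradiction (_ , _ , e) ¬e
    ; proper     = λ e _ _ _ → ¬e (_ , _ , e)
    }

  -- Colouring uv by u + v is proper, so the least number of colours exists.
  sumColouring : EdgeColouring G (n + n)
  sumColouring = record
    { colour     = λ {u} {v} _ → c u v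
    ; colour-sym = λ {u} {v} _ _ → toℕ-injective
        (trans (toℕ-c u v) (trans (+-comm (toℕ u) (toℕ v)) (sym (toℕ-c v u))))
    ; proper     = λ {u} {v} {w} _ _ v≢w q → v≢w (toℕ-injective
        (+-cancelˡ-≡ (toℕ u) (toℕ v) (toℕ w)
          (trans (sym (toℕ-c u v)) (trans (cong toℕ q) (toℕ-c u w)))))
    }
    where
    c : Fin n → Fin n → Fin (n + n)
    c u v = fromℕ< (+-mono-< (toℕ<n u) (toℕ<n v))
    toℕ-c : ∀ u v → toℕ (c u v) ≡ toℕ u + toℕ v
    toℕ-c u v = toℕ-fromℕ< (+-mono-< (toℕ<n u) (toℕ<n v))

  leastColouring : ∃ (IsLeast (EdgeColouring G))
  leastColouring = least edgeColouring? (n + n) sumColouring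

  χ′ : ℕ
  χ′ = proj₁ leastColouring

  χ′-isLeast : IsLeast (EdgeColouring G) χ′
  χ′-isLeast = proj₂ leastColouring

  Class2 : Set
  Class2 = χ′ ≡ Δ G + 1

CriticalEdge : ∀ {n} → Graph n → Fin n → Fin n → Set
CriticalEdge G u v = Graph._~_ G u v × χ′ (deleteEdge G u v) < χ′ G

{-# OPTIONS --safe #-}

-- Colour G − rs with Δ colours. From s or w follow the paths which step from a missing
-- colour c of a vertex to the neighbour v of r with rv coloured c, and on to a colour
-- missing at v. Provided the start shares no missing colour with r in any colouring,
-- recolouring and Kempe changes show that such paths avoid the colours missing at r and
-- never merge, so they end at distinct Δ-neighbours of r. As r is light, two paths from s
-- (which misses two colours) leave no room for a third one, starting at a colour missing
-- at w. That r and w share no missing colour is seen by the same count: if they did, then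
-- the colour of sw could be exchanged with either of the two colours missing at s, and so
-- it would start a third path at s.
module Submission where

open import Data.Bool using (Bool; true; false; if_then_else_; not)
import Data.Bool.Properties as Bool
open import Data.Empty using (⊥)
open import Data.Fin using (Fin; zero; suc; toℕ; inject≤)
open import Data.Fin.Patterns using (0F; 1F; 2F)
open import Data.Fin.Permutation.Components using (transpose; transpose-inverse)
open import Data.Fin.Properties
  using (_≟_; any?; toℕ<n; pigeonhole; inject≤-injective; suc-injective)
open import Data.Fin.Subset
  using (Subset; inside; outside; ⊤; ⁅_⁆; _∈_; _∉_; _∩_; _─_; _-_; ∣_∣)
open import Data.Fin.Subset.Properties
  using (_∈?_; ∈⊤; x∈⁅x⁆; x∈p∩q⁺; p─q⊆p; x∈p∧x≢y⇒x∈p-y; x∈p⇒∣p-x∣<∣p∣)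
open import Data.List using (map; allFin)
open import Data.List.Extrema.Nat using (xs≤max)
import Data.List.Relation.Unary.All as All
open import Data.List.Membership.Propositional.Properties using (∈-map⁺; ∈-allFin)
open import Data.Maybe as Maybe using (Maybe; just; nothing)
import Data.Maybe.Properties as Maybe
open import Data.Nat using (ℕ; zero; suc; _≤_; _<_; z≤n; s≤s)
open import Data.Nat.Properties
  using (≤-refl; ≤-trans; <-≤-trans; ≤-<-trans; <-irrefl; m≤n⇒m≤1+n; ≤∧≢⇒<; +-comm;
         m≤n⇒m<n∨m≡n)
  renaming (_≟_ to _≟ℕ_)
open import Data.Product using (∃; ∃₂; ∃-syntax; _×_; _,_; proj₁; proj₂; map₂)
open import Data.Sum using (_⊎_; inj₁; inj₂; [_,_]′; swap)
open import Data.Vec using (_∷_; here; there)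
open import Data.Vec.Properties using ([]=⇒lookup; lookup⇒[]=; lookup∘tabulate)
open import Function using (_∘_; id; case_of_)
open import Function.Definitions using (Injective)
open import Relation.Binary.PropositionalEquality
  using (_≡_; _≢_; refl; sym; trans; cong; subst; ≢-sym)
open import Relation.Nullary
  using (¬_; Dec; yes; no; does; contradiction; ¬?; _×-dec_; _⊎-dec_)
open import Relation.Nullary.Decidable using (dec-true; decidable-stable)
open import Defs

-- Finite subsets and transpositions.

x∈p─q⇒x∉q : ∀ {n} {x : Fin n} (p q : Subset n) → x ∈ p ─ q → x ∉ q
x∈p─q⇒x∉q (inside ∷ p) (outside ∷ q) here ()
x∈p─q⇒x∉q (_ ∷ p) (outside ∷ q) (there x∈) (there x∈q) = x∈p─q⇒x∉q p q x∈ x∈q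
x∈p─q⇒x∉q (_ ∷ p) (inside ∷ q) (there x∈) (there x∈q) = x∈p─q⇒x∉q p q x∈ x∈q

injection⇒≤∣p∣ : ∀ {n} k (p : Subset n) (f : Fin k → Fin n) → Injective _≡_ _≡_ f →
                 (∀ i → f i ∈ p) → k ≤ ∣ p ∣
injection⇒≤∣p∣ zero    p f f-inj f∈p = z≤n
injection⇒≤∣p∣ (suc k) p f f-inj f∈p =
  ≤-<-trans (injection⇒≤∣p∣ k (p - f zero) (f ∘ suc) (suc-injective ∘ f-inj)
              (λ i → x∈p∧x≢y⇒x∈p-y (f∈p (suc i)) (λ eq → case f-inj eq of λ ())))
            (x∈p⇒∣p-x∣<∣p∣ (f∈p zero))

module _ {k : ℕ} (a b : Fin k) where

  transpose-left : transpose a b a ≡ b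
  transpose-left rewrite dec-true (a ≟ a) refl = refl

  transpose-right : transpose a b b ≡ a
  transpose-right with b ≟ a
  ... | yes eq = eq
  ... | no _ rewrite dec-true (b ≟ b) refl = refl

  transpose-other : ∀ {c} → c ≢ a → c ≢ b → transpose a b c ≡ c
  transpose-other {c} c≢a c≢b with c ≟ a
  ... | yes eq = contradiction eq c≢a
  ... | no _ with c ≟ b
  ...   | yes eq = contradiction eq c≢b
  ...   | no _   = refl

  transpose-injective : Injective _≡_ _≡_ (transpose a b)
  transpose-injective {x} {y} eq =
    trans (sym (transpose-inverse b a))
          (trans (cong (transpose b a) eq) (transpose-inverse b a))

-- Neighbourhoods and degrees.

module _ {n : ℕ} (G : Graph n) where
  open Graph G

  ~⇒∈N : ∀ {u v} → u ~ v → v ∈ N G u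
  ~⇒∈N {u} {v} e = lookup⇒[]= v _ (trans (lookup∘tabulate _ v) (dec-true (u ~? v) e))

  ∈N⇒~ : ∀ {u v} → v ∈ N G u → u ~ v
  ∈N⇒~ {u} {v} v∈ with u ~? v | trans (sym (lookup∘tabulate _ v)) ([]=⇒lookup v∈)
  ... | yes e | _ = e
  ... | no _  | ()

  ∈verticesOfDegree : ∀ {k v} → d G v ≡ k → v ∈ verticesOfDegree G k
  ∈verticesOfDegree {k} {v} eq =
    lookup⇒[]= v _ (trans (lookup∘tabulate _ v) (dec-true (d G v ≟ℕ k) eq))

  d≤Δ : ∀ v → d G v ≤ Δ G
  d≤Δ v = All.lookup (xs≤max 0 (map (d G) (allFin n))) (∈-map⁺ (d G) (∈-allFin v))

abstract
  -- Kept abstract so that `does` of it stays one neutral term for later case distinctions, instead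
  -- of unfolding to a Boolean combination of vertex comparisons.
  sameEdge? : ∀ {n} (G : Graph n) a b u v → Dec (SameEdge G a b u v)
  sameEdge? G a b u v = (u ≟ a ×-dec v ≟ b) ⊎-dec (u ≟ b ×-dec v ≟ a)

-- Partial edge colourings and missing colours.

module Colourings {n : ℕ} (G : Graph n) (k : ℕ) (r s : Fin n) where
  open Graph G

  private
    V = Fin n
    C = Fin k

  -- A proper edge colouring of G in which at most the edge rs has no colour;
  -- nothing also marks the non-edges.
  record Colouring : Set where
    field
      col       : V → V → Maybe C
      col-sym   : ∀ u v → col u v ≡ col v u
      col-inj   : ∀ {u v w c} → col u v ≡ just c → col u w ≡ just c → v ≡ w
      col-edge  : ∀ {u v c} → col u v ≡ just c → u ~ v
      col-total : ∀ {u v} → u ~ v → col u v ≡ nothing → SameEdge G r s u v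

  open Colouring

  Present Missing : Colouring → V → C → Set
  Present φ v c = ∃[ u ] col φ v u ≡ just c
  Missing φ v c = ¬ Present φ v c

  present? : ∀ φ v c → Dec (Present φ v c)
  present? φ v c = any? λ u → Maybe.≡-dec _≟_ (col φ v u) (just c)

  flip-col : ∀ φ {u v c} → col φ u v ≡ just c → col φ v u ≡ just c
  flip-col φ {u} {v} e = trans (col-sym φ v u) e

  col-func : ∀ φ {u v c c′} → col φ u v ≡ just c → col φ u v ≡ just c′ → c ≡ c′
  col-func φ e f = Maybe.just-injective (trans (sym e) f)

  present⊎missing : ∀ φ v → (∃[ c ] Missing φ v c) ⊎ (∀ c → Present φ v c)
  present⊎missing φ v with any? (λ c → ¬? (present? φ v c))
  ... | yes (c , mc) = inj₁ (c , mc)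
  ... | no ¬m = inj₂ λ c → decidable-stable (present? φ v c) (λ mc → ¬m (c , mc))

  at-colour-injective : ∀ φ v (p : ∀ c → Present φ v c) → Injective _≡_ _≡_ (proj₁ ∘ p)
  at-colour-injective φ v p {c} {c′} eq =
    col-func φ (subst (λ u → col φ v u ≡ just c) eq (proj₂ (p c))) (proj₂ (p c′))

  -- If no colour were missing, the `k` colours would lead to `k` distinct neighbours of `v`.
  small-degree⇒missing : ∀ φ v → d G v < k → ∃[ c ] Missing φ v c
  small-degree⇒missing φ v d<k with present⊎missing φ v
  ... | inj₁ m = m
  ... | inj₂ p = contradiction
    (≤-<-trans (injection⇒≤∣p∣ k (N G v) (proj₁ ∘ p) (at-colour-injective φ v p)
                 (λ c → ~⇒∈N G (col-edge φ (proj₂ (p c)))))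
               d<k)
    (<-irrefl refl)

  -- Changing the colour of a single edge.

  module _ (φ : Colouring) (u v : V) (x : C) (u~v : u ~ v)
           (mu : Missing φ u x) (mv : Missing φ v x) where

    private
      same? : ∀ p q → Dec (SameEdge G u v p q)
      same? = sameEdge? G u v

      col′ : V → V → Maybe C
      col′ p q = if does (same? p q) then just x else col φ p q

      same-swap : ∀ {p q} → SameEdge G u v p q → SameEdge G u v q p
      same-swap (inj₁ (e , f)) = inj₂ (f , e)
      same-swap (inj₂ (e , f)) = inj₁ (f , e)

      same-inj : ∀ {p q q′} → SameEdge G u v p q → SameEdge G u v p q′ → q ≡ q′
      same-inj (inj₁ (_ , e)) (inj₁ (_ , f)) = trans e (sym f)
      same-inj (inj₁ (e , _)) (inj₂ (f , _)) = contradiction u~v (~-irrefl (trans (sym e) f))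
      same-inj (inj₂ (e , _)) (inj₁ (f , _)) = contradiction u~v (~-irrefl (trans (sym f) e))
      same-inj (inj₂ (_ , e)) (inj₂ (_ , f)) = trans e (sym f)

      same-edge : ∀ {p q} → SameEdge G u v p q → p ~ q
      same-edge (inj₁ (refl , refl)) = u~v
      same-edge (inj₂ (refl , refl)) = ~-sym u~v

      same-missing : ∀ {p q} → SameEdge G u v p q → Missing φ p x
      same-missing (inj₁ (refl , _)) = mu
      same-missing (inj₂ (refl , _)) = mv

    -- The edge may be uncoloured beforehand, so the same operation also serves to colour `rs`.
    recolour : Colouring
    recolour .col = col′
    recolour .col-sym p q with same? p q | same? q p
    ... | yes e | yes f = refl
    ... | yes e | no ¬f = contradiction (same-swap e) ¬f
    ... | no ¬e | yes f = contradiction (same-swap f) ¬e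
    ... | no ¬e | no ¬f = col-sym φ p q
    recolour .col-inj {p} {q} {q′} e f with same? p q | same? p q′
    ... | yes i | yes j = same-inj i j
    recolour .col-inj refl f | yes i | no _ = contradiction (_ , f) (same-missing i)
    recolour .col-inj e refl | no _ | yes j = contradiction (_ , e) (same-missing j)
    ... | no _  | no _  = col-inj φ e f
    recolour .col-edge {p} {q} e with same? p q
    ... | yes i = same-edge i
    ... | no _  = col-edge φ e
    recolour .col-total {p} {q} e eq with same? p q
    ... | no _ = col-total φ e eq

    recolour-at : col recolour u v ≡ just x
    recolour-at with same? u v
    ... | yes _ = refl
    ... | no ¬e = contradiction (inj₁ (refl , refl)) ¬e

    recolour-else : ∀ p q → ¬ SameEdge G u v p q → col recolour p q ≡ col φ p q
    recolour-else p q ¬e with same? p q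
    ... | yes e = contradiction e ¬e
    ... | no _  = refl

    recolour-missing : ∀ {p c} → c ≢ x → Missing φ p c → Missing recolour p c
    recolour-missing {p} c≢x mc (q , eq) with same? p q
    ... | yes _ = c≢x (sym (Maybe.just-injective eq))
    ... | no _  = mc (q , eq)

    recolour-missing-away : ∀ {p c} → p ≢ u → p ≢ v → Missing φ p c → Missing recolour p c
    recolour-missing-away {p} p≢u p≢v mc (q , eq) with same? p q
    ... | yes (inj₁ (e , _)) = p≢u e
    ... | yes (inj₂ (e , _)) = p≢v e
    ... | no _ = mc (q , eq)

    recolour-missing-left : ∀ {c} → col φ u v ≡ just c → Missing recolour u c
    recolour-missing-left {c} e (q , eq) with same? u q
    ... | yes _ = mu (v , trans e (sym eq))
    ... | no ¬i = ¬i (inj₁ (refl , col-inj φ eq e))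

    recolour-missing-right : ∀ {c} → col φ u v ≡ just c → Missing recolour v c
    recolour-missing-right {c} e (q , eq) with same? v q
    ... | yes _ = mu (v , trans e (sym eq))
    ... | no ¬i = ¬i (inj₂ (refl , col-inj φ eq (flip-col φ e)))

  -- Kempe changes.

  -- S is a union of components of the subgraph formed by the colours a and b.
  Closed : Colouring → C → C → (V → Bool) → Set
  Closed φ a b S = ∀ u v c → c ≡ a ⊎ c ≡ b → col φ u v ≡ just c → S u ≡ S v

  module _ (φ : Colouring) (a b : C) (S : V → Bool) (closed : Closed φ a b S) where

    private
      exchange : Bool → Maybe C → Maybe C
      exchange true  = Maybe.map (transpose a b)
      exchange false = id

      exchange-other : ∀ i {c} → c ≢ a → c ≢ b → exchange i (just c) ≡ just c
      exchange-other true  c≢a c≢b = cong just (transpose-other a b c≢a c≢b)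
      exchange-other false c≢a c≢b = refl

      exchange-injective : ∀ i → Injective _≡_ _≡_ (exchange i)
      exchange-injective true  = Maybe.map-injective (transpose-injective a b)
      exchange-injective false = id

      exchange-just : ∀ i x {c} → exchange i x ≡ just c → ∃[ c′ ] x ≡ just c′
      exchange-just true  (just c) e = c , refl
      exchange-just false (just c) e = c , refl

      exchange-nothing : ∀ i x → exchange i x ≡ nothing → x ≡ nothing
      exchange-nothing true  nothing e = refl
      exchange-nothing false nothing e = refl

    kempe : Colouring
    -- Consulting `S` at one end only is still symmetric: `closed` puts both ends of an edge
    -- coloured `a` or `b` on the same side, and all other colours are fixed.
    kempe .col u v = exchange (S u) (col φ u v)
    kempe .col-sym u v rewrite col-sym φ v u with col φ u v in eq
    ... | nothing = trans (nothing-fixed (S u)) (sym (nothing-fixed (S v)))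
      where
      nothing-fixed : ∀ i → exchange i nothing ≡ nothing
      nothing-fixed true  = refl
      nothing-fixed false = refl
    ... | just c with c ≟ a ⊎-dec c ≟ b
    ...   | yes c∈ = cong (λ i → exchange i (just c)) (closed u v c c∈ eq)
    ...   | no c∉  = trans (exchange-other (S u) (c∉ ∘ inj₁) (c∉ ∘ inj₂))
                       (sym (exchange-other (S v) (c∉ ∘ inj₁) (c∉ ∘ inj₂)))
    kempe .col-inj {u} {v} {w} e f with exchange-just (S u) (col φ u v) e
    ... | c , eq = col-inj φ eq (trans (exchange-injective (S u) (trans f (sym e))) eq)
    kempe .col-edge {u} {v} e = col-edge φ (proj₂ (exchange-just (S u) (col φ u v) e))
    kempe .col-total {u} {v} e eq = col-total φ e (exchange-nothing (S u) (col φ u v) eq)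

    kempe-outside : ∀ {u} v → S u ≡ false → col kempe u v ≡ col φ u v
    kempe-outside v eq rewrite eq = refl

    kempe-missing-outside : ∀ {v c} → S v ≡ false → Missing φ v c → Missing kempe v c
    kempe-missing-outside eq mc (u , e) = mc (u , trans (sym (kempe-outside u eq)) e)

    kempe-missing-other : ∀ {v c} → c ≢ a → c ≢ b → Missing φ v c → Missing kempe v c
    kempe-missing-other {v} {c} c≢a c≢b mc (u , e) =
      mc (u , exchange-injective (S v) (trans e (sym (exchange-other (S v) c≢a c≢b))))

    kempe-missing-left : ∀ {v} → S v ≡ true → Missing φ v a → Missing kempe v b
    kempe-missing-left {v} eq ma (u , e) rewrite eq =
      ma (u , exchange-injective true (trans e (cong just (sym (transpose-left a b)))))

    kempe-missing-right : ∀ {v} → S v ≡ true → Missing φ v b → Missing kempe v a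
    kempe-missing-right {v} eq mb (u , e) rewrite eq =
      mb (u , exchange-injective true (trans e (cong just (sym (transpose-right a b)))))

  -- Ends of two-coloured chains.

  -- Follows the chain from x inside U; the walk leaves U behind it, so that the
  -- continuation again starts at an end of a chain.
  chain-within : ∀ fuel φ (U : Subset n) a b x y z → ∣ U ∣ ≤ fuel →
    x ∈ U → (∀ v → v ∈ U → col φ x v ≢ just b) →
    x ≢ y → x ≢ z → y ≢ z → Missing φ y a ⊎ Missing φ y b → Missing φ z a ⊎ Missing φ z b →
    ∃[ S ] S x ≡ true × (S y ≡ false ⊎ S z ≡ false) ×
      (∀ u v c → u ∈ U → v ∈ U → c ≡ a ⊎ c ≡ b → col φ u v ≡ just c → S u ≡ S v)
  chain-within zero φ U a b x y z size x∈U _ _ _ _ _ _ =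
    contradiction (<-≤-trans (x∈p⇒∣p-x∣<∣p∣ x∈U) size) (λ ())
  chain-within (suc fuel) φ U a b x y z size x∈U ¬b x≢y x≢z y≢z my mz
    with any? (λ v → v ∈? U ×-dec Maybe.≡-dec _≟_ (col φ x v) (just a))
  -- Inside `U` no edge of either colour is left at `x`, so the chain is `x` alone.
  ... | no ¬a = S , dec-true (x ≟ x) refl , inj₁ (outside-S x≢y) , closed
    where
    S : V → Bool
    S v = does (v ≟ x)
    outside-S : ∀ {v} → x ≢ v → S v ≡ false
    outside-S {v} x≢v with v ≟ x
    ... | yes eq = contradiction (sym eq) x≢v
    ... | no _ = refl
    no-edge : ∀ v c → v ∈ U → c ≡ a ⊎ c ≡ b → col φ x v ≢ just c
    no-edge v c v∈U (inj₁ refl) e = ¬a (v , v∈U , e)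
    no-edge v c v∈U (inj₂ refl) e = ¬b v v∈U e
    closed : ∀ u v c → u ∈ U → v ∈ U → c ≡ a ⊎ c ≡ b → col φ u v ≡ just c → S u ≡ S v
    closed u v c u∈U v∈U c∈ e with u ≟ x | v ≟ x
    ... | yes refl | _ = contradiction e (no-edge v c v∈U c∈)
    ... | no _ | yes refl = contradiction (flip-col φ e) (no-edge u c u∈U c∈)
    ... | no _ | no _ = refl
  ... | yes (x′ , x′∈U , e₀) = result
    where
    x′≢x : x′ ≢ x
    x′≢x eq = ~-irrefl (sym eq) (col-edge φ e₀)

    U′ = U - x

    x∉U′ : x ∉ U′
    x∉U′ x∈ = x∈p─q⇒x∉q U ⁅ x ⁆ x∈ (x∈⁅x⁆ x)

    -- Inside `U` the only edge of the two colours at `x` goes to `x′`, which is already in `S′`;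
    -- adding `x` therefore breaks nothing.
    extend : ∀ (S′ : V → Bool) → S′ x′ ≡ true →
      (∀ u v c → u ∈ U′ → v ∈ U′ → c ≡ b ⊎ c ≡ a → col φ u v ≡ just c → S′ u ≡ S′ v) →
      ∃[ S ] S x ≡ true × (∀ v → v ≢ x → S v ≡ S′ v) ×
        (∀ u v c → u ∈ U → v ∈ U → c ≡ a ⊎ c ≡ b → col φ u v ≡ just c → S u ≡ S v)
    extend S′ S′x′ closed′ = S , at-x , off-x , closed
      where
      S : V → Bool
      S v = if does (v ≟ x) then true else S′ v
      at-x : S x ≡ true
      at-x rewrite dec-true (x ≟ x) refl = refl
      off-x : ∀ v → v ≢ x → S v ≡ S′ v
      off-x v v≢x with v ≟ x
      ... | yes eq = contradiction eq v≢x
      ... | no _ = refl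
      from-x : ∀ v c → v ∈ U → c ≡ a ⊎ c ≡ b → col φ x v ≡ just c → true ≡ S′ v
      from-x v c v∈U (inj₁ refl) e = trans (sym S′x′) (cong S′ (col-inj φ e₀ e))
      from-x v c v∈U (inj₂ refl) e = contradiction e (¬b v v∈U)
      closed : ∀ u v c → u ∈ U → v ∈ U → c ≡ a ⊎ c ≡ b → col φ u v ≡ just c → S u ≡ S v
      closed u v c u∈U v∈U c∈ e with u ≟ x | v ≟ x
      ... | yes refl | yes refl = refl
      ... | yes refl | no _ = from-x v c v∈U c∈ e
      ... | no _ | yes refl = sym (from-x u c u∈U c∈ (flip-col φ e))
      ... | no u≢x | no v≢x =
        closed′ u v c (x∈p∧x≢y⇒x∈p-y u∈U u≢x) (x∈p∧x≢y⇒x∈p-y v∈U v≢x) (swap c∈) e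

    -- If x′ is y or z then the chain ends there.
    ends : ∀ {v} → x′ ≡ v → Missing φ v a ⊎ Missing φ v b →
      (∀ u v c → u ∈ U′ → v ∈ U′ → c ≡ b ⊎ c ≡ a → col φ u v ≡ just c →
        does (u ≟ x′) ≡ does (v ≟ x′))
    ends refl (inj₁ ma) = contradiction (x , flip-col φ e₀) ma
    ends refl (inj₂ mb) = closed
      where
      no-edge : ∀ v c → v ∈ U′ → c ≡ b ⊎ c ≡ a → col φ x′ v ≢ just c
      no-edge v c v∈ (inj₁ refl) e = mb (v , e)
      no-edge v c v∈ (inj₂ refl) e =
        x∉U′ (subst (_∈ U′) (col-inj φ e (flip-col φ e₀)) v∈)
      closed : ∀ u v c → u ∈ U′ → v ∈ U′ → c ≡ b ⊎ c ≡ a → col φ u v ≡ just c →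
        does (u ≟ x′) ≡ does (v ≟ x′)
      closed u v c u∈ v∈ c∈ e with u ≟ x′ | v ≟ x′
      ... | yes refl | _ = contradiction e (no-edge v c v∈ c∈)
      ... | no _ | yes refl = contradiction (flip-col φ e) (no-edge u c u∈ c∈)
      ... | no _ | no _ = refl

    not-x′ : ∀ {v} → v ≢ x′ → does (v ≟ x′) ≡ false
    not-x′ {v} v≢x′ with v ≟ x′
    ... | yes eq = contradiction eq v≢x′
    ... | no _ = refl

    result : ∃[ S ] S x ≡ true × (S y ≡ false ⊎ S z ≡ false) ×
      (∀ u v c → u ∈ U → v ∈ U → c ≡ a ⊎ c ≡ b → col φ u v ≡ just c → S u ≡ S v)
    result with x′ ≟ y | x′ ≟ z
    ... | yes refl | _ with extend (λ v → does (v ≟ x′)) (dec-true (x′ ≟ x′) refl) (ends refl my)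
    ...   | S , Sx , off , cl = S , Sx , inj₂ (trans (off z (≢-sym x≢z)) (not-x′ (≢-sym y≢z))) , cl
    result | no _ | yes refl
      with extend (λ v → does (v ≟ x′)) (dec-true (x′ ≟ x′) refl) (ends refl mz)
    ...   | S , Sx , off , cl = S , Sx , inj₁ (trans (off y (≢-sym x≢y)) (not-x′ y≢z)) , cl
    result | no x′≢y | no x′≢z
      with chain-within fuel φ U′ b a x′ y z
             (case <-≤-trans (x∈p⇒∣p-x∣<∣p∣ x∈U) size of λ { (s≤s le) → le })
             (x∈p∧x≢y⇒x∈p-y x′∈U x′≢x)
             -- The colours change roles: the edge of colour `a` at `x′` leads back to `x`, which
             -- has been removed.
             (λ v v∈ e → x∉U′ (subst (_∈ U′) (col-inj φ e (flip-col φ e₀)) v∈))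
             x′≢y x′≢z y≢z (swap my) (swap mz)
    ... | S′ , S′x′ , yz , cl′ with extend S′ S′x′ cl′
    ...   | S , Sx , off , cl =
      S , Sx , [ inj₁ ∘ trans (off y (≢-sym x≢y)) , inj₂ ∘ trans (off z (≢-sym x≢z)) ]′ yz , cl

  -- A chain has only two ends.
  chain-end : ∀ φ a b x y z → x ≢ y → x ≢ z → y ≢ z →
    Missing φ x a ⊎ Missing φ x b → Missing φ y a ⊎ Missing φ y b →
    Missing φ z a ⊎ Missing φ z b →
    ∃[ S ] Closed φ a b S × S x ≡ true × (S y ≡ false ⊎ S z ≡ false)
  chain-end φ a b x y z x≢y x≢z y≢z (inj₂ mx) my mz
    with chain-within _ φ ⊤ a b x y z ≤-refl ∈⊤ (λ v _ e → mx (v , e)) x≢y x≢z y≢z my mz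
  ... | S , Sx , yz , cl = S , (λ u v c → cl u v c ∈⊤ ∈⊤) , Sx , yz
  chain-end φ a b x y z x≢y x≢z y≢z (inj₁ mx) my mz
    with chain-within _ φ ⊤ b a x y z ≤-refl ∈⊤ (λ v _ e → mx (v , e)) x≢y x≢z y≢z
           (swap my) (swap mz)
  ... | S , Sx , yz , cl = S , (λ u v c → cl u v c ∈⊤ ∈⊤ ∘ swap) , Sx , yz

  -- Conversion to and from edge colourings.

  fromEdgeColouring : EdgeColouring (deleteEdge G r s) k → Colouring
  fromEdgeColouring E = record
    { col       = λ u v → at (u ~?ᴴ v)
    ; col-sym   = λ u v → at-sym (u ~?ᴴ v) (v ~?ᴴ u)
    ; col-inj   = λ {u} {v} {w} → at-inj (u ~?ᴴ v) (u ~?ᴴ w)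
    ; col-edge  = λ {u} {v} → at-edge (u ~?ᴴ v)
    ; col-total = λ {u} {v} → at-total (u ~?ᴴ v)
    }
    where
    open Graph (deleteEdge G r s) using () renaming (_~_ to _~ᴴ_; _~?_ to _~?ᴴ_; ~-sym to ~ᴴ-sym)
    open EdgeColouring E

    at : ∀ {u v} → Dec (u ~ᴴ v) → Maybe C
    at (yes e) = just (colour e)
    at (no _)  = nothing

    at-sym : ∀ {u v} (p : Dec (u ~ᴴ v)) (q : Dec (v ~ᴴ u)) → at p ≡ at q
    at-sym (yes e) (yes f) = cong just (colour-sym e f)
    at-sym (yes e) (no ¬f) = contradiction (~ᴴ-sym e) ¬f
    at-sym (no ¬e) (yes f) = contradiction (~ᴴ-sym f) ¬e
    at-sym (no _)  (no _)  = refl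

    at-inj : ∀ {u v w c} (p : Dec (u ~ᴴ v)) (q : Dec (u ~ᴴ w)) →
             at p ≡ just c → at q ≡ just c → v ≡ w
    at-inj {v = v} {w} (yes e) (yes f) refl eq = decidable-stable (v ≟ w) λ v≢w →
      proper e f v≢w (sym (Maybe.just-injective eq))

    at-edge : ∀ {u v c} (p : Dec (u ~ᴴ v)) → at p ≡ just c → u ~ v
    at-edge (yes (e , _)) _ = e

    at-total : ∀ {u v} (p : Dec (u ~ᴴ v)) → u ~ v → at p ≡ nothing → SameEdge G r s u v
    at-total {u} {v} (no ¬e) e _ =
      decidable-stable (sameEdge? G r s u v) (λ ¬i → ¬e (e , ¬i))

  toEdgeColouring : (φ : Colouring) → (∃[ c ] col φ r s ≡ just c) → EdgeColouring G k
  toEdgeColouring φ (x , rs) = record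
    { colour     = λ e → proj₁ (full e)
    ; colour-sym = λ e f → col-func φ (proj₂ (full e)) (flip-col φ (proj₂ (full f)))
    ; proper     = λ e f v≢w eq → v≢w
        (col-inj φ (proj₂ (full e)) (trans (proj₂ (full f)) (cong just (sym eq))))
    }
    where
    full : ∀ {u v} → u ~ v → ∃[ c ] col φ u v ≡ just c
    full {u} {v} e with col φ u v in eq
    ... | just c = c , refl
    ... | nothing with col-total φ e eq
    ...   | inj₁ (refl , refl) = case trans (sym eq) rs of λ ()
    ...   | inj₂ (refl , refl) = case trans (sym eq) (flip-col φ rs) of λ ()

  -- Paths of missing colours around `r`.

  -- Path φ t a i z c: there are vertices t = u₀, …, uᵢ = z and colours
  -- a = c₀, …, cᵢ = c such that ruⱼ has colour cⱼ₋₁ and uⱼ misses cⱼ for 0 < j.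
  -- That t misses a is a separate hypothesis of the lemmas which need it.
  data Path (φ : Colouring) (t : V) (a : C) : ℕ → V → C → Set where
    start : Path φ t a 0 t a
    step  : ∀ {i u v c c′} → Path φ t a i u c → col φ r v ≡ just c → Missing φ v c′ →
            Path φ t a (suc i) v c′

  path-missing : ∀ {φ t a i z c} → Missing φ t a → Path φ t a i z c → Missing φ z c
  path-missing ma start          = ma
  path-missing ma (step _ _ mc) = mc

  path-prefix : ∀ {φ t a} i {j z c} → i ≤ j → Path φ t a j z c → ∃₂ (Path φ t a i)
  path-prefix i i≤j p with m≤n⇒m<n∨m≡n i≤j
  path-prefix i i≤j p              | inj₂ refl      = _ , _ , p
  path-prefix i i≤j (step p e mc) | inj₁ (s≤s i≤j′) = path-prefix i i≤j′ p

  -- The conditions range over all colourings, so that they remain available after any recolouring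
  -- or Kempe change.
  record Blocked (t : V) : Set where
    field
      t≢r       : t ≢ r
      apart     : ∀ φ c → col φ r t ≢ just c
      no-common : ∀ φ c → Missing φ r c → Missing φ t c → ⊥

  open Blocked

  near≢ : ∀ {t} → Blocked t → ∀ φ {v c} → col φ r v ≡ just c → v ≢ t
  near≢ bt φ e refl = apart bt φ _ e

  near≢r : ∀ φ {v c} → col φ r v ≡ just c → v ≢ r
  near≢r φ e refl = ~-irrefl refl (col-edge φ e)

  path≢r : ∀ {t} → Blocked t → ∀ {φ a i z c} → Path φ t a i z c → z ≢ r
  path≢r bt start                  = t≢r bt
  path≢r bt {φ = φ} (step _ e _) = near≢r φ e

  -- Recolouring the last edge rv of the path with c frees the preceding colour at r,
  -- and the path without v is still a path.
  private
    path-avoids-bounded : ∀ {t} → Blocked t → ∀ fuel φ {a i z c} → i ≤ fuel → Missing φ t a →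
      Path φ t a i z c → ¬ Missing φ r c
    path-avoids-bounded bt fuel φ i≤ ma start mr = no-common bt φ _ mr ma
    path-avoids-bounded {t} bt (suc fuel) φ {a} {suc i} {v} {c} (s≤s i≤) ma
      (step {c = c₀} p e mc) mr = finish (transport p)
      where
      φ′ = recolour φ r v c (col-edge φ e) mr mc

      -- Only `r` and `v` are affected by the recolouring. If the path has visited `v` before, the
      -- part preceding that visit ends with `c₀`, the colour of `rv`; it is shorter, and appending
      -- `v` to it gives a path to which induction applies.
      transport : ∀ {j u d} → Path φ t a j u d →
        Path φ′ t a j u d ⊎ ∃₂ λ j′ u′ → j′ < j × Path φ t a j′ u′ c₀
      transport start = inj₁ start
      transport (step {v = w} {c = d} q f mw) with w ≟ v
      ... | yes refl with col-func φ e f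
      ...   | refl = inj₂ (_ , _ , ≤-refl , q)
      transport (step {v = w} q f mw) | no w≢v with transport q
      ... | inj₂ (j′ , u′ , j′< , q′) = inj₂ (j′ , u′ , m≤n⇒m≤1+n j′< , q′)
      ... | inj₁ q′ = inj₁ (step q′ (trans (recolour-else φ r v c (col-edge φ e) mr mc r w not-same) f)
                             (recolour-missing-away φ r v c (col-edge φ e) mr mc (near≢r φ f) w≢v mw))
        where
        not-same : ¬ SameEdge G r v r w
        not-same (inj₁ (_ , w≡v)) = w≢v w≡v
        not-same (inj₂ (r≡v , _)) = near≢r φ e (sym r≡v)

      finish : Path φ′ t a i _ c₀ ⊎ (∃₂ λ j′ u′ → j′ < i × Path φ t a j′ u′ c₀) → ⊥
      finish (inj₁ p′) = path-avoids-bounded bt fuel φ′ i≤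
        (recolour-missing-away φ r v c (col-edge φ e) mr mc (t≢r bt) (≢-sym (near≢ bt φ e)) ma) p′
        (recolour-missing-left φ r v c (col-edge φ e) mr mc e)
      finish (inj₂ (j′ , u′ , j′< , q)) =
        path-avoids-bounded bt fuel φ (≤-trans j′< i≤) ma (step q e mc) mr

  path-avoids : ∀ {t} → Blocked t → ∀ φ {a i z c} → Missing φ t a → Path φ t a i z c →
                ¬ Missing φ r c
  path-avoids bt φ = path-avoids-bounded bt _ φ ≤-refl

  private
    -- Exchanging `m` and `c` on `S` leaves all edges at `r` as they are but makes `m` missing at
    -- `z`, so the path would end with a colour missing at `r`. If `m` replaces `c` at an earlier
    -- vertex, the same contradiction arises there.
    not-separated : ∀ {t} → Blocked t → ∀ φ {a i z c m} S → Closed φ m c S →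
      Missing φ r m → Missing φ t a → Path φ t a i z c → S r ≡ false → S z ≢ true
    not-separated {t} bt φ {a} {c = c} {m} S closed mr ma p Sr Sz = finish p Sz
      where
      φ′ = kempe φ m c S closed

      mr′ : Missing φ′ r m
      mr′ = kempe-missing-outside φ m c S closed Sr mr

      missing′ : ∀ {v x} → x ≢ m → Missing φ v x → Missing φ′ v x ⊎ Missing φ′ v m
      missing′ {v} {x} x≢m mx with x ≟ c | S v Bool.≟ true
      ... | no x≢c  | _     = inj₁ (kempe-missing-other φ m c S closed x≢m x≢c mx)
      ... | yes _    | no ¬Sv = inj₁ (kempe-missing-outside φ m c S closed (Bool.¬-not ¬Sv) mx)
      ... | yes refl | yes Sv = inj₂ (kempe-missing-right φ m c S closed Sv mx)

      path≢m : ∀ {j u x} → Path φ t a j u x → x ≢ m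
      path≢m q refl = path-avoids bt φ ma q mr

      ma′ : Missing φ′ t a
      ma′ with missing′ (path≢m start) ma
      ... | inj₁ mx = mx
      ... | inj₂ mm = contradiction mm (no-common bt φ′ m mr′)

      r-edge : ∀ {v x} → col φ r v ≡ just x → col φ′ r v ≡ just x
      r-edge {v} e = trans (kempe-outside φ m c S closed v Sr) e

      transport : ∀ {j u x} → Path φ t a j u x → Path φ′ t a j u x
      transport start = start
      transport q₀@(step q e mx) with missing′ (path≢m q₀) mx
      ... | inj₁ mx′ = step (transport q) (r-edge e) mx′
      ... | inj₂ mm  =
        contradiction mr′ (path-avoids bt φ′ ma′ (step (transport q) (r-edge e) mm))

      finish : ∀ {j u} → Path φ t a j u c → S u ≢ true
      finish start Su = no-common bt φ′ m mr′ (kempe-missing-right φ m c S closed Su ma)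
      finish (step q e mx) Su = path-avoids bt φ′ ma′
        (step (transport q) (r-edge e) (kempe-missing-right φ m c S closed Su mx)) mr′

  path-linked : ∀ {t} → Blocked t → ∀ φ {a i z c m} S → Closed φ m c S →
    Missing φ r m → Missing φ t a → Path φ t a i z c → S r ≡ S z
  path-linked bt φ {z = z} S closed mr ma p with S r in er | S z in ez
  ... | true  | true  = refl
  ... | false | false = refl
  ... | false | true  = contradiction ez (not-separated bt φ S closed mr ma p er)
  -- The complement of a closed set is closed, which exchanges the two sides.
  ... | true  | false = contradiction (cong not ez)
    (not-separated bt φ (not ∘ S) (λ u v c c∈ e → cong not (closed u v c c∈ e)) mr ma p
      (cong not er))

  -- A third end of an (m , c)-chain lies on a chain of its own when r and z are linked.
  separate : ∀ {t} → Blocked t → ∀ φ {a i z c m} → Missing φ r m → Missing φ t a →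
    Path φ t a i z c → ∀ v → v ≢ r → v ≢ z → Missing φ v m ⊎ Missing φ v c →
    ∃[ S ] Closed φ m c S × S v ≡ true × S r ≡ false × S z ≡ false
  separate bt φ {z = z} {c} {m} mr ma p v v≢r v≢z mv
    with chain-end φ m c v r z v≢r v≢z (≢-sym (path≢r bt p)) mv (inj₁ mr)
           (inj₂ (path-missing ma p))
  ... | S , closed , Sv , inj₁ Sr =
    S , closed , Sv , Sr , trans (sym (path-linked bt φ S closed mr ma p)) Sr
  ... | S , closed , Sv , inj₂ Sz =
    S , closed , Sv , trans (path-linked bt φ S closed mr ma p) Sz , Sz

  -- Otherwise `r`, `z` and `z′` would be three ends of one chain in the colours `m` and `c`, as
  -- both paths link their ends to `r`.
  missing-unique : ∀ {t t′} → Blocked t → Blocked t′ → ∀ φ {m a a′ i i′ z z′ c} →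
    Missing φ r m → Missing φ t a → Missing φ t′ a′ →
    Path φ t a i z c → Path φ t′ a′ i′ z′ c → z ≡ z′
  missing-unique bt bt′ φ {z = z} {z′} mr ma ma′ p p′ = decidable-stable (z ≟ z′) λ z≢z′ →
    case separate bt φ mr ma p z′ (path≢r bt′ p′) (≢-sym z≢z′) (inj₂ (path-missing ma′ p′)) of
    λ (S , closed , Sz′ , Sr , _) → case trans (sym Sr)
      (trans (path-linked bt′ φ S closed mr ma′ p′) Sz′) of λ ()

  -- Counting the ends of paths.

  module _ (light : ∣ N G r ∩ verticesOfDegree G k ∣ ≤ 2) (d≤k : ∀ v → d G v ≤ k) where

    -- The paths from distinct starts share no colour and never repeat one, so each of
    -- them ends at a k-vertex of its own.
    no-three-starts : ∀ φ (t : Fin 3 → V) (a : Fin 3 → C) →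
      (∀ i c → col φ r (t i) ≢ just c) →
      (∀ i j → t i ≡ t j → a i ≡ a j → i ≡ j) →
      (∀ i {l z c} → Path φ (t i) (a i) l z c → ¬ Missing φ r c) →
      (∀ i j {l l′ z z′ c} → Path φ (t i) (a i) l z c → Path φ (t j) (a j) l′ z′ c → z ≡ z′) →
      ⊥
    no-three-starts φ t a apart-t distinct avoids unique =
      contradiction (≤-trans (injection⇒≤∣p∣ 3 _ end end-injective end∈) light)
        λ { (s≤s (s≤s ())) }
      where
      -- The two paths are traced back together: equal colours give equal vertices by `unique`, and
      -- the colour of the edge from `r` determines the colour before. Both reach their starts at
      -- once, since no coloured edge joins `r` to a start.
      same-start : ∀ i j {l l′ z z′ c c′} → Path φ (t i) (a i) l z c →
        Path φ (t j) (a j) l′ z′ c′ → c ≡ c′ → i ≡ j × l ≡ l′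

      same-end : ∀ i j {l l′ z z′ c c′} → Path φ (t i) (a i) l z c →
        Path φ (t j) (a j) l′ z′ c′ → z ≡ z′ → c ≡ c′ → i ≡ j × l ≡ l′
      same-end i j start start eq eq′ = distinct i j eq eq′ , refl
      same-end i j start (step q e _) refl _ = contradiction e (apart-t i _)
      same-end i j (step p e _) start refl _ = contradiction e (apart-t j _)
      same-end i j (step p e _) (step q f _) refl _ =
        map₂ (cong suc) (same-start i j p q (col-func φ e f))

      same-start i j p q refl = same-end i j p q (unique i j p q) refl

      End : Fin 3 → Set
      End i = ∃[ v ] d G v ≡ k × ∃[ c ] col φ r v ≡ just c × ∃₂ λ l z → Path φ (t i) (a i) l z c

      extend : ∀ i l → End i ⊎ ∃₂ (Path φ (t i) (a i) l)
      extend i zero = inj₂ (_ , _ , start)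
      extend i (suc l) with extend i l
      ... | inj₁ e = inj₁ e
      ... | inj₂ (z , c , p) with decidable-stable (present? φ r c) (avoids i p)
      ...   | v , e with d G v ≟ℕ k
      ...     | yes dv = inj₁ (v , dv , c , e , l , z , p)
      ...     | no dv with small-degree⇒missing φ v (≤∧≢⇒< (d≤k v) dv)
      ...       | c′ , mc = inj₂ (v , c′ , step p e mc)

      ends : ∀ i → End i
      ends i with extend i k
      ... | inj₁ e = e
      ... | inj₂ (_ , _ , p) =
        -- A path with `k` steps has `k + 1` prefixes but only `k` colours to end with; two prefixes
        -- of different lengths share a colour, against `same-start`.
        case pigeonhole ≤-refl (λ l → proj₁ (proj₂ (prefix l))) of λ (l , l′ , l<l′ , eq) →
          contradiction l<l′ (<-irrefl (proj₂ (same-start i i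
            (proj₂ (proj₂ (prefix l))) (proj₂ (proj₂ (prefix l′))) eq)))
        where
        prefix : (l : Fin (suc k)) → ∃₂ (Path φ (t i) (a i) (toℕ l))
        prefix l = path-prefix (toℕ l) (case toℕ<n l of λ { (s≤s l≤k) → l≤k }) p

      end : Fin 3 → V
      end i = proj₁ (ends i)

      end∈ : ∀ i → end i ∈ N G r ∩ verticesOfDegree G k
      end∈ i with ends i
      ... | v , dv , c , e , _ = x∈p∩q⁺ (~⇒∈N G (col-edge φ e) , ∈verticesOfDegree G dv)

      end-injective : Injective _≡_ _≡_ end
      end-injective {i} {j} eq with ends i | ends j
      ... | v , _ , c , e , _ , _ , p | v′ , _ , c′ , e′ , _ , _ , p′ with eq
      ...   | refl with col-func φ e e′
      ...     | refl = proj₁ (same-start i j p p′ refl)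

    -- Colours missing at both `r` and `w`.

    module _ (bs : Blocked s) (r-missing : ∀ φ → ∃[ c ] Missing φ r c)
             (w : V) (w≢r : w ≢ r) (¬r~w : ¬ r ~ w) (s~w : s ~ w) where

      private
        w-apart : ∀ φ c → col φ r w ≢ just c
        w-apart φ c e = ¬r~w (col-edge φ e)

        w≢s : w ≢ s
        w≢s eq = ~-irrefl (sym eq) s~w

        sw-not-rs : ∀ {v} → ¬ SameEdge G s w r v
        sw-not-rs (inj₁ (r≡s , _)) = t≢r bs (sym r≡s)
        sw-not-rs (inj₂ (r≡w , _)) = w≢r (sym r≡w)

      -- φ′ arises from φ, where both r and w miss m, by giving sw the colour α missing at s.
      record Shifted (φ φ′ : Colouring) (m α lam : C) : Set where
        field
          r-edges : ∀ v → col φ′ r v ≡ col φ r v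
          s-w     : col φ′ s w ≡ just α
          s-old   : Missing φ′ s lam
          w-old   : Missing φ′ w lam
          s-keeps : ∀ {c} → c ≢ α → Missing φ s c → Missing φ′ s c
          keeps   : ∀ {v c} → v ≢ s → v ≢ w → c ≢ m → c ≢ α → Missing φ v c → Missing φ′ v c
          keeps-m : ∀ {v} → v ≢ s → v ≢ w → Missing φ v m → Missing φ′ v m ⊎ Missing φ′ v α
      open Shifted

      -- The chain in `m` and `α` that ends at `r` ends also at `s`, so `w` lies on another one. A
      -- Kempe change there makes `α` missing at `w` as well as at `s`, and `sw` can take it.
      shift : ∀ φ {m α lam} → Missing φ r m → Missing φ w m → Missing φ s α →
        col φ s w ≡ just lam → ∃[ φ′ ] Shifted φ φ′ m α lam
      shift φ {m} {α} {lam} mr mw ms sw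
        with separate bs φ mr ms start w w≢r w≢s (inj₁ mw)
      ... | S , closed , Sw , Sr , Ss = φ₂ , record
        { r-edges = λ v → trans (recolour-else φ₁ s w α s~w ms₁ mw₁ r v sw-not-rs)
                                (kempe-outside φ m α S closed v Sr)
        ; s-w     = recolour-at φ₁ s w α s~w ms₁ mw₁
        ; s-old   = recolour-missing-left φ₁ s w α s~w ms₁ mw₁ sw₁
        ; w-old   = recolour-missing-right φ₁ s w α s~w ms₁ mw₁ sw₁
        ; s-keeps = λ c≢α mc → recolour-missing φ₁ s w α s~w ms₁ mw₁ c≢α
                                 (kempe-missing-outside φ m α S closed Ss mc)
        ; keeps   = λ v≢s v≢w c≢m c≢α mc → recolour-missing-away φ₁ s w α s~w ms₁ mw₁ v≢s v≢w
                      (kempe-missing-other φ m α S closed c≢m c≢α mc)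
        ; keeps-m = keeps-m′
        }
        where
        φ₁ = kempe φ m α S closed
        ms₁ : Missing φ₁ s α
        ms₁ = kempe-missing-outside φ m α S closed Ss ms
        mw₁ : Missing φ₁ w α
        mw₁ = kempe-missing-left φ m α S closed Sw mw
        sw₁ : col φ₁ s w ≡ just lam
        sw₁ = trans (kempe-outside φ m α S closed w Ss) sw
        φ₂ = recolour φ₁ s w α s~w ms₁ mw₁
        keeps-m′ : ∀ {v} → v ≢ s → v ≢ w → Missing φ v m → Missing φ₂ v m ⊎ Missing φ₂ v α
        keeps-m′ {v} v≢s v≢w mm with S v Bool.≟ true
        ... | yes Sv = inj₂ (recolour-missing-away φ₁ s w α s~w ms₁ mw₁ v≢s v≢w
                         (kempe-missing-left φ m α S closed Sv mm))
        ... | no ¬Sv = inj₁ (recolour-missing-away φ₁ s w α s~w ms₁ mw₁ v≢s v≢w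
                         (kempe-missing-outside φ m α S closed (Bool.¬-not ¬Sv) mm))

      -- Beyond `s` the path never uses `m`, by `path-avoids`, nor `x`: the trivial path at `s` ends
      -- with `x` too, and `missing-unique` would make the vertex equal to `s`. So a change in `m`
      -- and `x` does not disturb it.
      carry : ∀ {φ φ′ m x a i z c} → (∀ v → col φ′ r v ≡ col φ r v) →
        (∀ {v c} → v ≢ s → v ≢ w → c ≢ m → c ≢ x → Missing φ v c → Missing φ′ v c) →
        Missing φ r m → Missing φ s x → Missing φ s a →
        Path φ s a i z c → Path φ′ s a i z c
      carry r-edges keeps mr mx ma start = start
      carry {φ} {φ′} {m} {x} r-edges keeps mr mx ma p₀@(step {v = v} {c′ = c′} p e mc) =
        step (carry r-edges keeps mr mx ma p) (trans (r-edges v) e)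
          (keeps (near≢ bs φ e) (λ { refl → w-apart φ _ e }) c≢m c≢x mc)
        where
        c≢m : c′ ≢ m
        c≢m refl = path-avoids bs φ ma p₀ mr
        c≢x : c′ ≢ x
        c≢x refl = near≢ bs φ e (missing-unique bs bs φ mr ma mx p₀ start)

      module _ (φ : Colouring) {m α β lam : C} (mr : Missing φ r m) (mw : Missing φ w m)
               (mα : Missing φ s α) (mβ : Missing φ s β) (α≢β : α ≢ β)
               (sw : col φ s w ≡ just lam) where

        -- Giving `β` to `sw` frees `lam` at `s` and preserves the path, which would then end with
        -- the same colour as the trivial path at `s`.
        path-avoids-sw : ∀ {i z} → ¬ Path φ s α i z lam
        path-avoids-sw start = mα (w , sw)
        path-avoids-sw p₀@(step p e ml) with shift φ mr mw mβ sw
        ... | φ′ , sh = near≢ bs φ e (missing-unique bs bs φ′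
          (λ (v , f) → mr (v , trans (sym (r-edges sh v)) f)) (s-keeps sh α≢β mα) (s-old sh)
          (carry (r-edges sh) (keeps sh) mr mβ mα p₀) start)

      module _ (φ : Colouring) {m α β lam : C} (mr : Missing φ r m) (mw : Missing φ w m)
               (mα : Missing φ s α) (mβ : Missing φ s β) (α≢β : α ≢ β)
               (sw : col φ s w ≡ just lam) where

        private
          -- In both colourings `s` misses `lam`, together with `β` in `φα` and with `α` in `φβ`.
          -- Paths starting with `lam` are compared with those starting with `β` in the former and
          -- with `α` in the latter.
          φα = proj₁ (shift φ mr mw mα sw)
          sα = proj₂ (shift φ mr mw mα sw)
          φβ = proj₁ (shift φ mr mw mβ sw)
          sβ = proj₂ (shift φ mr mw mβ sw)

          lam≢ : ∀ {c} → Missing φ s c → lam ≢ c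
          lam≢ mc refl = mc (w , sw)

          m≢ : ∀ {c} → Missing φ s c → c ≢ m
          m≢ mc refl = no-common bs φ m mr mc

          r-keeps-α : ∀ {c} → Missing φ r c → Missing φα r c
          r-keeps-α mc (v , e) = mc (v , trans (sym (r-edges sα v)) e)

          r-keeps-β : ∀ {c} → Missing φ r c → Missing φβ r c
          r-keeps-β mc (v , e) = mc (v , trans (sym (r-edges sβ v)) e)

          mβ-α : Missing φα s β
          mβ-α = s-keeps sα (≢-sym α≢β) mβ

          mα-β : Missing φβ s α
          mα-β = s-keeps sβ α≢β mα

          -- Exchanging m and lam at w restores the hypotheses of path-avoids-sw, with α
          -- and lam in each other's place.
          shifted-avoids : ∀ {i z} → ¬ Path φα s lam i z α
          shifted-avoids p
            with separate bs φα (r-keeps-α mr) (s-old sα) start w w≢r w≢s (inj₂ (w-old sα))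
          ... | S , closed , Sw , Sr , Ss = path-avoids-sw (kempe φα m lam S closed)
            (kempe-missing-outside φα m lam S closed Sr (r-keeps-α mr))
            (kempe-missing-right φα m lam S closed Sw (w-old sα))
            (kempe-missing-outside φα m lam S closed Ss (s-old sα))
            (kempe-missing-outside φα m lam S closed Ss mβ-α)
            (lam≢ mβ)
            (trans (kempe-outside φα m lam S closed w Ss) (s-w sα))
            (carry (λ v → kempe-outside φα m lam S closed v Sr)
              (λ _ _ → kempe-missing-other φα m lam S closed)
              (r-keeps-α mr) (s-old sα) (s-old sα) p)

          -- A later `α` is excluded in `φβ` and a later `β` in `φα`, where `s` misses that colour
          -- besides `lam`. A later `m` becomes `m` or `α` in `φα`: the first is missing at `r`, the
          -- second contradicts `shifted-avoids`.
          transport : ∀ {i z c} → Path φ s lam i z c →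
            (c ≢ m × c ≢ α × c ≢ β) × Path φα s lam i z c × Path φβ s lam i z c
          transport start =
            ((λ { refl → mw (s , flip-col φ sw) }) , lam≢ mα , lam≢ mβ) , start , start
          transport (step {v = v} {c′ = c} p e mc) with transport p
          ... | _ , pα , pβ = (c≢m , c≢α , c≢β) ,
              step pα eα (keeps sα v≢s v≢w c≢m c≢α mc) ,
              step pβ eβ (keeps sβ v≢s v≢w c≢m c≢β mc)
            where
            eα = trans (r-edges sα v) e
            eβ = trans (r-edges sβ v) e
            v≢s : v ≢ s
            v≢s = near≢ bs φ e
            v≢w : v ≢ w
            v≢w refl = w-apart φ _ e
            c≢α : c ≢ α
            c≢α refl = v≢s (missing-unique bs bs φβ (r-keeps-β mr) (s-old sβ) mα-β
              (step pβ eβ (keeps sβ v≢s v≢w (m≢ mα) α≢β mc)) start)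
            c≢β : c ≢ β
            c≢β refl = v≢s (missing-unique bs bs φα (r-keeps-α mr) (s-old sα) mβ-α
              (step pα eα (keeps sα v≢s v≢w (m≢ mβ) (≢-sym α≢β) mc)) start)
            c≢m : c ≢ m
            c≢m refl with keeps-m sα v≢s v≢w mc
            ... | inj₁ mm = path-avoids bs φα (s-old sα) (step pα eα mm) (r-keeps-α mr)
            ... | inj₂ mαv = shifted-avoids (step pα eα mαv)

          unique-lam-α : ∀ {i j z z′ c} → Path φ s lam i z c → Path φ s α j z′ c → z ≡ z′
          unique-lam-α p q = missing-unique bs bs φβ (r-keeps-β mr) (s-old sβ) mα-β
            (proj₂ (proj₂ (transport p))) (carry (r-edges sβ) (keeps sβ) mr mβ mα q)

          unique-lam-β : ∀ {i j z z′ c} → Path φ s lam i z c → Path φ s β j z′ c → z ≡ z′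
          unique-lam-β p q = missing-unique bs bs φα (r-keeps-α mr) (s-old sα) mβ-α
            (proj₁ (proj₂ (transport p))) (carry (r-edges sα) (keeps sα) mr mα mβ q)

        -- For the purpose of paths, s behaves as if it missed all of α, β and lam.
        no-shared-missing : ⊥
        no-shared-missing = no-three-starts φ (λ _ → s) first (λ _ → apart bs φ)
          (λ i j _ → distinct i j) avoids unique
          where
          first : Fin 3 → C
          first 0F = α
          first 1F = β
          first 2F = lam

          distinct : ∀ i j → first i ≡ first j → i ≡ j
          distinct 0F 0F _  = refl
          distinct 0F 1F eq = contradiction eq α≢β
          distinct 0F 2F eq = contradiction (sym eq) (lam≢ mα)
          distinct 1F 0F eq = contradiction (sym eq) α≢β
          distinct 1F 1F _  = refl
          distinct 1F 2F eq = contradiction (sym eq) (lam≢ mβ)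
          distinct 2F 0F eq = contradiction eq (lam≢ mα)
          distinct 2F 1F eq = contradiction eq (lam≢ mβ)
          distinct 2F 2F _  = refl

          avoids : ∀ i {l z c} → Path φ s (first i) l z c → ¬ Missing φ r c
          avoids 0F p = path-avoids bs φ mα p
          avoids 1F p = path-avoids bs φ mβ p
          avoids 2F p mc =
            path-avoids bs φα (s-old sα) (proj₁ (proj₂ (transport p))) (r-keeps-α mc)

          unique : ∀ i j {l l′ z z′ c} → Path φ s (first i) l z c →
            Path φ s (first j) l′ z′ c → z ≡ z′
          unique 0F 0F p q = missing-unique bs bs φ mr mα mα p q
          unique 0F 1F p q = missing-unique bs bs φ mr mα mβ p q
          unique 0F 2F p q = sym (unique-lam-α q p)
          unique 1F 0F p q = missing-unique bs bs φ mr mβ mα p q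
          unique 1F 1F p q = missing-unique bs bs φ mr mβ mβ p q
          unique 1F 2F p q = sym (unique-lam-β q p)
          unique 2F 0F p q = unique-lam-α p q
          unique 2F 1F p q = unique-lam-β p q
          unique 2F 2F p q = missing-unique bs bs φα (r-keeps-α mr) (s-old sα) (s-old sα)
            (proj₁ (proj₂ (transport p))) (proj₁ (proj₂ (transport q)))

      -- No colour is missing at `w`.

      module _ (s-missing : ∀ φ → ∃₂ λ α β → α ≢ β × Missing φ s α × Missing φ s β) where

        w-blocked : Blocked w
        w-blocked = record
          { t≢r       = w≢r
          ; apart     = w-apart
          ; no-common = λ φ m mr mw → case s-missing φ of λ (α , β , α≢β , mα , mβ) →
              no-shared-missing φ mr mw mα mβ α≢β (proj₂ (sw-coloured φ))
          }
          where
          sw-coloured : ∀ φ → ∃[ c ] col φ s w ≡ just c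
          sw-coloured φ with col φ s w in eq
          ... | just c = c , refl
          ... | nothing with col-total φ s~w eq
          ...   | inj₁ (s≡r , _) = contradiction s≡r (t≢r bs)
          ...   | inj₂ (_ , w≡r) = contradiction w≡r w≢r

        w-saturated : ∀ φ δ → ¬ Missing φ w δ
        w-saturated φ δ mδ with s-missing φ | r-missing φ
        ... | α , β , α≢β , mα , mβ | m , mr = no-three-starts φ origin first
          (λ i → apart (blocked i) φ) distinct
          (λ i → path-avoids (blocked i) φ (missing i))
          (λ i j → missing-unique (blocked i) (blocked j) φ mr (missing i) (missing j))
          where
          origin : Fin 3 → V
          origin 0F = s
          origin 1F = s
          origin 2F = w

          first : Fin 3 → C
          first 0F = α
          first 1F = β
          first 2F = δ

          blocked : ∀ i → Blocked (origin i)
          blocked 0F = bs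
          blocked 1F = bs
          blocked 2F = w-blocked

          missing : ∀ i → Missing φ (origin i) (first i)
          missing 0F = mα
          missing 1F = mβ
          missing 2F = mδ

          distinct : ∀ i j → origin i ≡ origin j → first i ≡ first j → i ≡ j
          distinct 0F 0F _ _  = refl
          distinct 0F 1F _ eq = contradiction eq α≢β
          distinct 0F 2F eq _ = contradiction (sym eq) w≢s
          distinct 1F 0F _ eq = contradiction (sym eq) α≢β
          distinct 1F 1F _ _  = refl
          distinct 1F 2F eq _ = contradiction (sym eq) w≢s
          distinct 2F 0F eq _ = contradiction eq w≢s
          distinct 2F 1F eq _ = contradiction eq w≢s
          distinct 2F 2F _ _  = refl

  -- Colours missing at `r` and `s`.

  module _ (uncolourable : ¬ EdgeColouring G k) (r~s : r ~ s) where

    rs-uncoloured : ∀ φ c → col φ r s ≢ just c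
    rs-uncoloured φ c e = uncolourable (toEdgeColouring φ (c , e))

    -- A colour missing at both ends of `rs` could be given to `rs`, which would colour all of `G`.
    s-blocked : Blocked s
    s-blocked = record
      { t≢r       = λ s≡r → ~-irrefl (sym s≡r) r~s
      ; apart     = rs-uncoloured
      ; no-common = λ φ c mr ms → rs-uncoloured (recolour φ r s c r~s mr ms) c
                                    (recolour-at φ r s c r~s mr ms)
      }

    -- As `rs` is uncoloured, the colours at `r` lead to neighbours other than `s`, of which there
    -- are fewer than `k`.
    missing-at-r : d G r ≡ k → ∀ φ → ∃[ c ] Missing φ r c
    missing-at-r dr φ with present⊎missing φ r
    ... | inj₁ m = m
    ... | inj₂ p = contradiction
      (≤-<-trans (injection⇒≤∣p∣ k (N G r - s) (proj₁ ∘ p) (at-colour-injective φ r p) near)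
                 (x∈p⇒∣p-x∣<∣p∣ (~⇒∈N G r~s)))
      (<-irrefl (sym dr))
      where
      near : ∀ c → proj₁ (p c) ∈ N G r - s
      near c = x∈p∧x≢y⇒x∈p-y (~⇒∈N G (col-edge φ (proj₂ (p c))))
        (λ eq → rs-uncoloured φ c (subst (λ v → col φ r v ≡ just c) eq (proj₂ (p c))))

    -- With only α missing, the k colours could be sent injectively to neighbours of s, α to r.
    two-missing-at-s : d G s < k → ∀ φ → ∃₂ λ α β → α ≢ β × Missing φ s α × Missing φ s β
    two-missing-at-s ds φ with small-degree⇒missing φ s ds
    ... | α , mα with any? (λ c → ¬? (α ≟ c) ×-dec ¬? (present? φ s c))
    ...   | yes (β , α≢β , mβ) = α , β , α≢β , mα , mβ
    ...   | no none = contradiction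
      (≤-<-trans (injection⇒≤∣p∣ k (N G s) (proj₁ ∘ at) at-injective
                   (λ c → ~⇒∈N G (at-edge (at c)))) ds)
      (<-irrefl refl)
      where
      At : C → V → Set
      At c v = (α ≡ c × v ≡ r) ⊎ col φ s v ≡ just c

      at : ∀ c → ∃ (At c)
      at c with α ≟ c
      ... | yes eq = r , inj₁ (eq , refl)
      ... | no α≢c = map₂ inj₂
        (decidable-stable (present? φ s c) (λ mc → none (c , α≢c , mc)))

      at-edge : ∀ {c} (x : ∃ (At c)) → s ~ proj₁ x
      at-edge (_ , inj₁ (_ , refl)) = ~-sym r~s
      at-edge (_ , inj₂ e) = col-edge φ e

      same-colour : ∀ {c c′ v} → At c v → At c′ v → c ≡ c′
      same-colour (inj₁ (eq , _)) (inj₁ (eq′ , _)) = trans (sym eq) eq′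
      same-colour (inj₁ (_ , refl)) (inj₂ e) = contradiction (flip-col φ e) (rs-uncoloured φ _)
      same-colour (inj₂ e) (inj₁ (_ , refl)) = contradiction (flip-col φ e) (rs-uncoloured φ _)
      same-colour (inj₂ e) (inj₂ f) = col-func φ e f

      at-injective : Injective _≡_ _≡_ (proj₁ ∘ at)
      at-injective {c} {c′} eq =
        same-colour (subst (At c) eq (proj₂ (at c))) (proj₂ (at c′))

-- Class 2 graphs and critical edges.

widen : ∀ {n} {G : Graph n} {j k} → j ≤ k → EdgeColouring G j → EdgeColouring G k
widen j≤k E = record
  { colour     = λ e → inject≤ (colour e) j≤k
  ; colour-sym = λ e f → cong (λ c → inject≤ c j≤k) (colour-sym e f)
  ; proper     = λ e f v≢w eq → proper e f v≢w (inject≤-injective j≤k j≤k _ _ eq)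
  }
  where open EdgeColouring E

class2⇒uncolourable : ∀ {n} (G : Graph n) → Class2 G → ¬ EdgeColouring G (Δ G)
class2⇒uncolourable G class2 E = contradiction
  (subst (_≤ Δ G) (trans class2 (+-comm (Δ G) 1)) (proj₂ (χ′-isLeast G) (Δ G) E)) (<-irrefl refl)

critical⇒colourable : ∀ {n} (G : Graph n) → Class2 G → ∀ {u v} → CriticalEdge G u v →
                      EdgeColouring (deleteEdge G u v) (Δ G)
critical⇒colourable G class2 {u} {v} (_ , χ<) =
  widen (case subst (χ′ H <_) (trans class2 (+-comm (Δ G) 1)) χ< of λ { (s≤s le) → le })
    (proj₁ (χ′-isLeast H))
  where H = deleteEdge G u v

theorem1p4 : (n : ℕ) (G : Graph n) → Class2 G →
    (r : Fin n) → Light G r → IsVertexOfDegree G (Δ G) r →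
    (s : Fin n) → s ∈ N G r → d G s < Δ G → CriticalEdge G r s →
    (w : Fin n) → w ∈ (N G s ─ N G r) → IsVertexOfDegree G (Δ G) w
theorem1p4 n G class2 r light dr s s∈ ds critical w w∈ = decidable-stable (d G w ≟ℕ Δ G) λ dw →
  let δ , mδ = small-degree⇒missing φ w (≤∧≢⇒< (d≤Δ G w) dw) in
  w-saturated light (d≤Δ G) (s-blocked uncolourable r~s) (missing-at-r uncolourable r~s dr)
    -- The vertex `r` also lies in `N G s ─ N G r`; it differs from `w` because its degree is `Δ G`.
    w (λ { refl → dw dr }) (λ r~w → x∈p─q⇒x∉q (N G s) (N G r) w∈ (~⇒∈N G r~w))
    (∈N⇒~ G (p─q⊆p (N G s) (N G r) w∈))
    (two-missing-at-s uncolourable r~s ds) φ δ mδ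
  where
  open Colourings G (Δ G) r s
  uncolourable = class2⇒uncolourable G class2
  r~s = ∈N⇒~ G s∈
  φ = fromEdgeColouring (critical⇒colourable G class2 critical)
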